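{- Let $P$ be a path whose vertex set is partitioned into $m$ nonempty subsets $V_1,\ldots,V_m$. Then there exist two disjoint independent sets $S_1$ and $S_2$ of $P$ such that $S_1\cup S_2$ contains all vertices of $P$ except exactly one vertex in each $V_j$, $\big||S_1|-|S_2|\big|\le 1$, and for each $i\in\{1,2\}$, $$|S_i\cap V_j|\ \ge\ \frac{|V_j|}{2}-1\qquad\text{for all } j\in[m].$$
   Context: An independent set of a graph is a set of vertices no two of which are adjacent. $[m]=\{1,\ldots,m\}$. -}

module Defs where

open import Data.Nat using (ℕ; suc; _+_; _*_; _≤_)
open import Data.Fin using (Fin; inject₁; fromℕ<; toℕ)
open import Data.Fin.Subset using (Subset; _∈_; _∉_; _∩_; _∪_; ∣_∣; Empty)
open import Data.Vec using (tabulate)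
open import Data.Bool using (Bool; true; false)
open import Relation.Nullary using (¬_)
open import Relation.Binary.PropositionalEquality using (_≡_)
open import Data.Product using (_×_; ∃-syntax)
open import Data.Fin using (_≟_)
open import Relation.Nullary.Decidable using (does)

-- The path P_n on vertex set Fin n: vertices i and i+1 are adjacent
-- (edges {inject₁ i , suc i} for i : Fin (n-1)).

IndependentPath : (n : ℕ) → Subset n → Set
IndependentPath n S = ∀ (i j : Fin n) → toℕ j ≡ suc (toℕ i) → ¬ (i ∈ S × j ∈ S)

part : {n m : ℕ} → (Fin n → Fin m) → Fin m → Subset n
part c j = tabulate (λ v → does (c v ≟ j))

Surjective : {n m : ℕ} → (Fin n → Fin m) → Set
Surjective {n} c = ∀ j → ∃[ v ] (c v ≡ j)

ExactlyOneMissing : {n m : ℕ} → (Fin n → Fin m) → Subset n → Fin m → Set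
ExactlyOneMissing c S j =
  ∃[ v ] (c v ≡ j × v ∉ S × (∀ w → c w ≡ j → w ∉ S → w ≡ v))

{-# OPTIONS --safe #-}
-- Deleting one vertex per colour and giving the remaining vertices alternating
-- signs yields two independent sets of almost equal size, so only the balance
-- of each colour is at stake.  Assume first that every class is odd.  There is
-- an odd number of choices of the deleted vertices.  Let N(q) be the number of
-- those with imbalance vector q when the first remaining vertex is positive.
-- If N(q) ≡ N(-q) mod 2 for all q, the vectors q ≠ 0 contribute an even number,
-- hence N(0) is odd.  In an even class the first vertex is kept and ignored in
-- the balance, which then is off by at most one.
--
-- For the symmetry, record with square-zero variables e_j which colours have
-- been deleted from and with x_j the imbalance.  Modulo 2 the two generating
-- functions V₊, V₋ (by initial sign) satisfy Σ_j (x_j + 1/x_j) ∂V_σ/∂e_j = V₊ + V₋,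
-- by induction on the path, and the left side has no coefficient at e_1 ⋯ e_m.
module Submission where

open import Defs
open import Algebra.Bundles using (CommutativeRing)
import Algebra.Properties.CommutativeSemigroup as CommutativeSemigroup
import Algebra.Properties.Semiring.Sum as Sum
open import Data.Bool using (Bool; true; false; not; _∧_; _∨_; _xor_; if_then_else_)
open import Data.Bool.Properties
  using (not-involutive; xor-same; xor-comm; xor-identityʳ; xor-inverseʳ;
         ∧-distribˡ-xor; ∧-zeroʳ; xor-∧-commutativeRing)
open import Data.Bool.Solver using (module xor-∧-Solver)
open import Data.Empty using (⊥)
open import Data.Fin using (Fin; toℕ; zero; suc; _≟_)
open import Data.Fin.Subset using (Subset; ⊤; ∣_∣; _∈_; _∉_; _∩_; _∪_; Empty) renaming (⊥ to ∅)
open import Data.Maybe using (Maybe; just; nothing)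
open import Data.Nat using (ℕ; zero; suc; _+_; _*_; _≤_; z≤n; s≤s; _≡ᵇ_; _<ᵇ_)
open import Data.Nat.Properties
  using (suc-injective; ≤-trans; ≤-reflexive; ≤-refl; m≤m+n; m≤n⇒m≤1+n;
         +-mono-≤; +-monoʳ-≤; +-comm; +-suc; module ≤-Reasoning)
open import Data.Nat.Solver using (module +-*-Solver)
open import Data.Product using (_×_; _,_; proj₁; proj₂; swap; ∃-syntax)
open import Data.Vec using (Vec; []; _∷_; lookup; _[_]%=_; tabulate; replicate; map; here; there)
open import Data.Vec.Properties
  using (updateAt-commutes; updateAt-updateAt; updateAt-id-local; lookup∘updateAt;
         lookup∘updateAt′; lookup-replicate; lookup∘tabulate; []=⇒lookup)
open import Function using (_∘_)
open import Relation.Binary.PropositionalEquality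
  using (_≡_; _≢_; refl; sym; trans; cong; cong₂; subst; module ≡-Reasoning)
open import Relation.Nullary using (does; yes; no; contradiction)

open Sum (CommutativeRing.semiring xor-∧-commutativeRing)
  using (sum; sum-cong-≗; ∑-distrib-+; *-distribˡ-sum; sum-replicate-zero)

open CommutativeSemigroup (CommutativeRing.+-commutativeSemigroup xor-∧-commutativeRing)
  using (interchange)

private variable
  m n : ℕ

-- Parities of numbers of signed walks

infix 4 _⊆ᵇ_

_⊆ᵇ_ : Subset m → Subset m → Bool
[]      ⊆ᵇ []      = true
(t ∷ T) ⊆ᵇ (u ∷ U) = (not t ∨ u) ∧ (T ⊆ᵇ U)

flip : Fin m → Subset m → Subset m
flip k T = T [ k ]%= not

-- Positive and negative counts stay separate instead of being subtracted: reversing signs is then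
-- `swap`, and imbalance zero is equality of the halves.
Tally : ℕ → Set
Tally m = Vec ℕ m × Vec ℕ m

add : Bool → Fin m → Tally m → Tally m
add true  k (x , y) = x [ k ]%= suc , y
add false k (x , y) = x , y [ k ]%= suc

-- A walk drops one vertex of each colour in T and gives the vertices it keeps
-- alternating signs, the first one σ (true is +).  Kept vertices are added to
-- the tally p, except that the first vertex of each colour in E has to be kept
-- and is not tallied.  The value is the parity of the number of walks whose
-- final tally satisfies h.
walks : (Tally m → Bool) → (n : ℕ) → (Fin n → Fin m) → (E T : Subset m) → Bool → Tally m → Bool
walks h zero    c E T σ p = (T ⊆ᵇ ∅) ∧ h p
walks h (suc n) c E T σ p =
  if lookup E k
  then walks h n (c ∘ suc) (flip k E) T (not σ) p
  else walks h n (c ∘ suc) E T (not σ) (add σ k p)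
       xor (lookup T k ∧ walks h n (c ∘ suc) E (flip k T) σ p)
  where k = c zero

-- The differential identity modulo 2

updateAt-comm : ∀ {A : Set} (f : A → A) (i j : Fin m) (xs : Vec A m) →
                (xs [ j ]%= f) [ i ]%= f ≡ (xs [ i ]%= f) [ j ]%= f
updateAt-comm f i j xs with i ≟ j
... | yes refl = refl
... | no i≢j   = updateAt-commutes i j i≢j xs

add-comm : ∀ σ τ (i j : Fin m) p → add σ i (add τ j p) ≡ add τ j (add σ i p)
add-comm true  true  i j (x , y) = cong (_, y) (updateAt-comm suc i j x)
add-comm true  false i j p       = refl
add-comm false true  i j p       = refl
add-comm false false i j (x , y) = cong (x ,_) (updateAt-comm suc i j y)

flip-flip : ∀ (k : Fin m) T → flip k (flip k T) ≡ T
flip-flip k T = trans (updateAt-updateAt k T) (updateAt-id-local k T (not-involutive _))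

flip∉∅ : ∀ (T : Subset m) j → lookup T j ≡ false → (flip j T ⊆ᵇ ∅) ≡ false
flip∉∅ (false ∷ T) zero    refl = refl
flip∉∅ (t ∷ T)     (suc j) eq rewrite flip∉∅ T j eq = ∧-zeroʳ (not t ∨ false)

sum-δ : ∀ (k : Fin m) x → sum (λ j → does (k ≟ j) ∧ x) ≡ x
sum-δ {suc m} zero    true  = cong not (sum-replicate-zero m)
sum-δ {suc m} zero    false = sum-replicate-zero m
sum-δ         (suc k) x     = sum-δ k x

-- The derivation Σ_j (x_j + 1/x_j) ∂/∂e_j on generating functions; the summand
-- for j vanishes at e_T when j ∈ T since e_j² = 0.
∂ : (Subset m → Tally m → Bool) → Subset m → Tally m → Fin m → Bool
∂ f T p j = not (lookup T j) ∧ (f (flip j T) (add true j p) xor f (flip j T) (add false j p))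

-- The Leibniz rule for the factor e_k contributed by a dropped vertex of colour k.
∂-drop : ∀ (f : Subset m → Tally m → Bool) k T p j →
         not (lookup T j) ∧ (lookup (flip j T) k ∧
           (f (flip k (flip j T)) (add true j p) xor f (flip k (flip j T)) (add false j p)))
         ≡ (lookup T k ∧ ∂ f (flip k T) p j)
           xor (does (k ≟ j) ∧ (f T (add true k p) xor f T (add false k p)))
∂-drop f k T p j with k ≟ j
... | yes refl rewrite lookup∘updateAt k {not} T | flip-flip k T with lookup T k
...   | true  = sym (xor-same (f T (add true k p) xor f T (add false k p)))
...   | false = refl
∂-drop f k T p j | no k≢j
  rewrite lookup∘updateAt′ k j {not} k≢j T
        | lookup∘updateAt′ j k {not} (k≢j ∘ sym) T
        | updateAt-comm not k j T
  with lookup T j | lookup T k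
... | true  | true  = refl
... | true  | false = refl
... | false | true  = sym (xor-identityʳ _)
... | false | false = refl

∂-walks : ∀ h n (c : Fin n → Fin m) E T σ p →
          sum (∂ (λ T → walks h n c E T σ) T p) ≡ walks h n c E T true p xor walks h n c E T false p
∂-walks {m} h zero c E T σ p = begin
  sum (∂ (λ T p → (T ⊆ᵇ ∅) ∧ h p) T p) ≡⟨ sum-cong-≗ vanish ⟩
  sum {m} (λ _ → false)               ≡⟨ sum-replicate-zero m ⟩
  false                               ≡⟨ xor-same ((T ⊆ᵇ ∅) ∧ h p) ⟨
  _                                   ∎
  where
  open ≡-Reasoning
  vanish : ∀ j → ∂ (λ T p → (T ⊆ᵇ ∅) ∧ h p) T p j ≡ false
  vanish j with lookup T j in eq
  ... | true  = refl
  ... | false rewrite flip∉∅ T j eq = refl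
∂-walks h (suc n) c E T σ p with lookup E (c zero)
-- A spared vertex only reverses the sign, which swaps the two summands on the right.
∂-walks h (suc n) c E T σ p | true =
  trans (∂-walks h n (c ∘ suc) _ T (not σ) p) (xor-comm (walks h n (c ∘ suc) _ T true p) _)
∂-walks h (suc n) c E T σ p | false = begin
  sum (∂ (λ T p → keep T σ p xor drop T σ p) T p)
    ≡⟨ sum-cong-≗ split ⟩
  sum (λ j → K j xor (t∧D j xor δ j))
    ≡⟨ trans (∑-distrib-+ K _) (cong (sum K xor_) (∑-distrib-+ t∧D δ)) ⟩
  sum K xor (sum t∧D xor sum δ)
    ≡⟨ cong₂ _xor_ (∂-walks h n c′ E T (not σ) (add σ k p))
         (cong₂ _xor_ (trans (sym (*-distribˡ-sum (lookup T k) (∂ (λ T → w T σ) (flip k T) p)))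
                        (trans (cong (lookup T k ∧_) (∂-walks h n c′ E (flip k T) σ p))
                               (∧-distribˡ-xor (lookup T k) _ _)))
                      (sum-δ k _)) ⟩
  (w T true (add σ k p) xor w T false (add σ k p))
    xor ((drop T true p xor drop T false p)
         xor (w T σ (add true k p) xor w T σ (add false k p)))
    -- The term x_k^σ V'_σ occurs twice, once from the kept branch and once from differentiating
    -- e_k.
    ≡⟨ cancel σ (λ τ υ → w T τ (add υ k p)) _ ⟩
  (w T false (add true k p) xor w T true (add false k p)) xor (drop T true p xor drop T false p)
    ≡⟨ interchange (w T false (add true k p)) _ _ _ ⟩
  (keep T true p xor drop T true p) xor (keep T false p xor drop T false p) ∎
  where
  open ≡-Reasoning
  k = c zero
  c′ = c ∘ suc
  w = walks h n c′ E
  keep drop : Subset _ → Bool → Tally _ → Bool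
  keep T σ p = w T (not σ) (add σ k p)
  drop T σ p = lookup T k ∧ w (flip k T) σ p
  K t∧D δ : Fin _ → Bool
  K   = ∂ (λ T → w T (not σ)) T (add σ k p)
  t∧D j = lookup T k ∧ ∂ (λ T → w T σ) (flip k T) p j
  δ j = does (k ≟ j) ∧ (w T σ (add true k p) xor w T σ (add false k p))

  open xor-∧-Solver
  cancel : ∀ σ (v : Bool → Bool → Bool) r →
           (v true σ xor v false σ) xor (r xor (v σ true xor v σ false))
           ≡ (v false true xor v true false) xor r
  cancel true  v r = solve 4 (λ a b c r → (a :+ b) :+ (r :+ (a :+ c)) := (b :+ c) :+ r) refl
                       (v true true) (v false true) (v true false) r
  cancel false v r = solve 4 (λ a b c r → (a :+ b) :+ (r :+ (c :+ b)) := (c :+ a) :+ r) refl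
                       (v true false) (v false false) (v false true) r

  expand : ∀ a b l x y z → a ∧ ((x xor (l ∧ y)) xor (z xor (l ∧ b)))
           ≡ (a ∧ (x xor z)) xor (a ∧ (l ∧ (y xor b)))
  expand false b l x y z = refl
  expand true  b l x y z = trans (interchange x _ _ _)
    (cong ((x xor z) xor_) (sym (∧-distribˡ-xor l y b)))

  split : ∀ j → ∂ (λ T p → keep T σ p xor drop T σ p) T p j ≡ K j xor (t∧D j xor δ j)
  split j rewrite add-comm σ true k j p | add-comm σ false k j p =
    trans (expand (not (lookup T j)) (u false) (lookup (flip j T) k) (v true) (u true) (v false))
          (cong (K j xor_) (∂-drop (λ T → w T σ) k T p j))
    where
    u v : Bool → Bool
    u τ = w (flip k (flip j T)) σ (add τ j p)
    v τ = w (flip j T) (not σ) (add τ j (add σ k p))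

walks-⊤ : ∀ h n (c : Fin n → Fin m) E p → walks h n c E ⊤ true p xor walks h n c E ⊤ false p ≡ false
walks-⊤ {m} h n c E p = begin
  walks h n c E ⊤ true p xor walks h n c E ⊤ false p ≡⟨ ∂-walks h n c E ⊤ true p ⟨
  sum (∂ (λ T → walks h n c E T true) ⊤ p)           ≡⟨ sum-cong-≗ vanish ⟩
  sum {m} (λ _ → false)                              ≡⟨ sum-replicate-zero m ⟩
  false                                              ∎
  where
  open ≡-Reasoning
  vanish : ∀ j → ∂ (λ T → walks h n c E T true) ⊤ p j ≡ false
  vanish j rewrite lookup-replicate j true = refl

-- Sign reversal and additivity in the final condition

add-swap : ∀ σ (k : Fin m) p → add (not σ) k (swap p) ≡ swap (add σ k p)
add-swap true  k p = refl
add-swap false k p = refl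

walks-swap : ∀ h n (c : Fin n → Fin m) E T σ p →
             walks h n c E T (not σ) (swap p) ≡ walks (h ∘ swap) n c E T σ p
walks-swap h zero    c E T σ p = refl
walks-swap h (suc n) c E T σ p
  rewrite add-swap σ (c zero) p
        | walks-swap h n (c ∘ suc) (flip (c zero) E) T (not σ) p
        | walks-swap h n (c ∘ suc) E T (not σ) (add σ (c zero) p)
        | walks-swap h n (c ∘ suc) E (flip (c zero) T) σ p
        = refl

walks-xor : ∀ g h n (c : Fin n → Fin m) E T σ p →
            walks (λ q → g q xor h q) n c E T σ p ≡ walks g n c E T σ p xor walks h n c E T σ p
walks-xor g h zero c E T σ p = ∧-distribˡ-xor (T ⊆ᵇ ∅) (g p) (h p)
walks-xor g h (suc n) c E T σ p with lookup E (c zero)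
... | true  = walks-xor g h n (c ∘ suc) _ T (not σ) p
... | false
  rewrite walks-xor g h n (c ∘ suc) E T (not σ) (add σ (c zero) p)
        | walks-xor g h n (c ∘ suc) E (flip (c zero) T) σ p
        | ∧-distribˡ-xor (lookup T (c zero)) (walks g n (c ∘ suc) E (flip (c zero) T) σ p)
                         (walks h n (c ∘ suc) E (flip (c zero) T) σ p)
        = interchange (walks g n (c ∘ suc) E T (not σ) (add σ (c zero) p)) _ _ _

-- The number of all walks modulo 2

oddColours : ∀ n → (Fin n → Fin m) → Subset m → Subset m
oddColours zero    c E = ∅
oddColours (suc n) c E =
  if lookup E k then oddColours n (c ∘ suc) (flip k E) else flip k (oddColours n (c ∘ suc) E)
  where k = c zero

-- `T ⊆ᵇ U` is the coefficient of e_T in the product of 1 + e_j over U. Multiplying by 1 + e_k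
-- toggles k in U, since (1 + e_k)² = 1 modulo 2.
⊆ᵇ-flip : ∀ k (T U : Subset m) → (T ⊆ᵇ flip k U) ≡ (T ⊆ᵇ U) xor (lookup T k ∧ (flip k T ⊆ᵇ U))
⊆ᵇ-flip zero    (true ∷ T)  (true ∷ U)  = sym (xor-same (T ⊆ᵇ U))
⊆ᵇ-flip zero    (true ∷ T)  (false ∷ U) = refl
⊆ᵇ-flip zero    (false ∷ T) (u ∷ U)     = sym (xor-identityʳ (T ⊆ᵇ U))
⊆ᵇ-flip (suc k) (t ∷ T)     (u ∷ U) rewrite ⊆ᵇ-flip k T U with not t ∨ u
... | true  = refl
... | false = sym (∧-zeroʳ (lookup T k))

-- Both sides are the parity of the product over T of the class sizes, where the
-- first vertex of each colour in E is discounted.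
walks-true : ∀ n (c : Fin n → Fin m) E T σ p →
             walks (λ _ → true) n c E T σ p ≡ (T ⊆ᵇ oddColours n c E)
walks-true zero c E T σ p with T ⊆ᵇ ∅
... | true  = refl
... | false = refl
walks-true (suc n) c E T σ p with lookup E (c zero)
... | true  = walks-true n (c ∘ suc) _ T (not σ) p
... | false
  rewrite walks-true n (c ∘ suc) E T (not σ) (add σ (c zero) p)
        | walks-true n (c ∘ suc) E (flip (c zero) T) σ p
        = sym (⊆ᵇ-flip (c zero) T (oddColours n (c ∘ suc) E))

isOdd : ℕ → Bool
isOdd zero    = false
isOdd (suc n) = not (isOdd n)

tail-occurs : ∀ {c : Fin (suc n) → Fin m} {j} → c zero ≢ j → ∃[ v ] c v ≡ j → ∃[ v ] c (suc v) ≡ j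
tail-occurs c₀≢j (zero  , eq) = contradiction eq c₀≢j
tail-occurs c₀≢j (suc v , eq) = v , eq

-- Discounting a vertex needs one to exist, hence `occurs`. Once it is met, its colour leaves `E`
-- and the condition becomes vacuous.
lookup-oddColours : ∀ n (c : Fin n → Fin m) E j → (lookup E j ≡ true → ∃[ v ] c v ≡ j) →
                    lookup (oddColours n c E) j ≡ isOdd ∣ part c j ∣ xor lookup E j
lookup-oddColours zero c E j occurs with lookup E j
... | true  with () ← proj₁ (occurs refl)
... | false = lookup-replicate j false
lookup-oddColours (suc n) c E j occurs with lookup E (c zero) in eq | c zero ≟ j
... | true | yes refl
  rewrite lookup-oddColours n (c ∘ suc) (flip (c zero) E) (c zero)
            (λ e → contradiction (trans (sym e) (trans (lookup∘updateAt (c zero) E) (cong not eq))) λ ())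
        | lookup∘updateAt (c zero) {not} E | eq
        with isOdd ∣ part (c ∘ suc) (c zero) ∣
...     | true  = refl
...     | false = refl
lookup-oddColours (suc n) c E j occurs | true | no c₀≢j
  rewrite sym (lookup∘updateAt′ j (c zero) {not} (c₀≢j ∘ sym) E)
        = lookup-oddColours n (c ∘ suc) _ j (tail-occurs c₀≢j ∘ occurs)
lookup-oddColours (suc n) c E j occurs | false | yes refl
  rewrite lookup∘updateAt (c zero) {not} (oddColours n (c ∘ suc) E)
        | lookup-oddColours n (c ∘ suc) E (c zero) (λ e → contradiction (trans (sym e) eq) λ ())
        | eq
        with isOdd ∣ part (c ∘ suc) (c zero) ∣
...     | true  = refl
...     | false = refl
lookup-oddColours (suc n) c E j occurs | false | no c₀≢j
  rewrite lookup∘updateAt′ j (c zero) {not} (c₀≢j ∘ sym) (oddColours n (c ∘ suc) E)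
        = lookup-oddColours n (c ∘ suc) E j (tail-occurs c₀≢j ∘ occurs)

⊤-⊆ᵇ : ∀ (U : Subset m) → (∀ j → lookup U j ≡ true) → (⊤ ⊆ᵇ U) ≡ true
⊤-⊆ᵇ []      all = refl
⊤-⊆ᵇ (u ∷ U) all rewrite all zero = ⊤-⊆ᵇ U (all ∘ suc)

evenColours : (Fin n → Fin m) → Subset m
evenColours c = tabulate λ j → not (isOdd ∣ part c j ∣)

oddColours-evenColours : ∀ (c : Fin n → Fin m) → Surjective c → ∀ j →
                         lookup (oddColours n c (evenColours c)) j ≡ true
oddColours-evenColours {n} c surj j
  rewrite lookup-oddColours n c (evenColours c) j (λ _ → surj j)
        | lookup∘tabulate (λ j → not (isOdd ∣ part c j ∣)) j
        = xor-inverseʳ (isOdd ∣ part c j ∣)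

-- Existence of a balanced walk

-- Lexicographic comparison, so that exactly one of leads xs ys and leads ys xs
-- holds unless xs ≡ ys: it selects one of q and -q for each imbalance q ≠ 0.
leads : Vec ℕ m → Vec ℕ m → Bool
leads []       []       = false
leads (x ∷ xs) (y ∷ ys) = (y <ᵇ x) ∨ ((x ≡ᵇ y) ∧ leads xs ys)

-- At the first differing entries exactly one side leads, so there the hypothesis computes to
-- `false ≡ true`.
leads-swap : ∀ (xs ys : Vec ℕ m) → not (leads xs ys xor leads ys xs) ≡ true → xs ≡ ys
leads-swap []       []       eq = refl
leads-swap (zero ∷ xs) (zero ∷ ys) eq = cong (zero ∷_) (leads-swap xs ys eq)
leads-swap (suc x ∷ xs) (suc y ∷ ys) eq with leads-swap (x ∷ xs) (y ∷ ys) eq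
... | refl = refl

-- Equality of the halves, written as a sum modulo 2 so that `walks-xor` can split it.
balanced : Tally m → Bool
balanced p = not (leads (proj₁ p) (proj₂ p) xor leads (proj₂ p) (proj₁ p))

start : Tally m
start = replicate _ 0 , replicate _ 0

-- The total is odd. Sign reversal turns the walks whose second half leads into walks with initial
-- sign - whose first half leads, and `walks-⊤` cancels these against those with initial sign +.
walks-balanced : ∀ (c : Fin n → Fin m) → Surjective c →
                 walks balanced n c (evenColours c) ⊤ true start ≡ true
walks-balanced {n} c surj = begin
  w balanced true
    ≡⟨ walks-xor (λ _ → true) _ n c E ⊤ true start ⟩
  w (λ _ → true) true xor w (λ p → h p xor h (swap p)) true
    ≡⟨ cong₂ _xor_ (trans (walks-true n c E ⊤ true start) (⊤-⊆ᵇ _ (oddColours-evenColours c surj)))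
         (walks-xor h (h ∘ swap) n c E ⊤ true start) ⟩
  not (w h true xor w (h ∘ swap) true)
    ≡⟨ cong (λ b → not (w h true xor b)) (walks-swap h n c E ⊤ true start) ⟨
  not (w h true xor w h false)
    ≡⟨ cong not (walks-⊤ h n c E start) ⟩
  true ∎
  where
  open ≡-Reasoning
  E = evenColours c
  h : Tally _ → Bool
  h p = leads (proj₁ p) (proj₂ p)
  w : (Tally _ → Bool) → Bool → Bool
  w h σ = walks h n c E ⊤ σ start

data Walk (h : Tally m → Bool) :
          (c : Fin n → Fin m) (E T : Subset m) → Bool → Tally m → Vec (Maybe Bool) n → Set where
  stop  : ∀ {c E T σ p} → (T ⊆ᵇ ∅) ≡ true → h p ≡ true → Walk h {zero} c E T σ p []
  spare : ∀ {c E T σ p z} → lookup E (c zero) ≡ true →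
          Walk h {n} (c ∘ suc) (flip (c zero) E) T (not σ) p z →
          Walk h c E T σ p (just σ ∷ z)
  keep  : ∀ {c E T σ p z} →
          Walk h {n} (c ∘ suc) E T (not σ) (add σ (c zero) p) z →
          Walk h c E T σ p (just σ ∷ z)
  drop  : ∀ {c E T σ p z} → lookup T (c zero) ≡ true →
          Walk h {n} (c ∘ suc) E (flip (c zero) T) σ p z →
          Walk h c E T σ p (nothing ∷ z)

-- A sum that is 1 modulo 2 has a summand that is 1; the kept branch is tried first.
walks⇒Walk : ∀ h n (c : Fin n → Fin m) E T σ p → walks h n c E T σ p ≡ true → ∃[ z ] Walk h c E T σ p z
walks⇒Walk h zero c E T σ p eq with T ⊆ᵇ ∅ in T⊆∅ | h p in hp
... | true | true = [] , stop T⊆∅ hp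
walks⇒Walk h (suc n) c E T σ p eq with lookup E (c zero) in e
... | true  = let z , w = walks⇒Walk h n (c ∘ suc) _ T (not σ) p eq in _ , spare e w
... | false with walks h n (c ∘ suc) E T (not σ) (add σ (c zero) p) in kept | lookup T (c zero) in t
...   | true  | _    = let z , w = walks⇒Walk h n (c ∘ suc) E T (not σ) _ kept in _ , keep w
...   | false | true = let z , w = walks⇒Walk h n (c ∘ suc) E _ σ p eq in _ , drop t w

-- Independence and sizes of the two sign classes

hasSign : Bool → Maybe Bool → Bool
hasSign true  (just x) = x
hasSign false (just x) = not x
hasSign _     nothing  = false

signed : Bool → Vec (Maybe Bool) n → Subset n
signed b = map (hasSign b)

hasSign-not : ∀ b σ → hasSign b (just σ) ≡ true → hasSign b (just (not σ)) ≡ true → ⊥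
hasSign-not true  true  refl ()
hasSign-not false false refl ()

private variable
  h : Tally m → Bool
  c : Fin n → Fin m
  E T : Subset m
  σ : Bool
  p : Tally m
  z : Vec (Maybe Bool) n

head-sign : ∀ b → Walk h c E T σ p z → zero ∈ signed b z → hasSign b (just σ) ≡ true
head-sign b (spare _ _) v∈S = []=⇒lookup v∈S
head-sign b (keep _)    v∈S = []=⇒lookup v∈S
head-sign true  (drop _ _) ()
head-sign false (drop _ _) ()

independent-∷ : ∀ {b} {S : Subset n} → (b ≡ true → ∀ v → toℕ v ≡ 0 → v ∉ S) →
                IndependentPath n S → IndependentPath (suc n) (b ∷ S)
independent-∷ h ind zero    (suc j) eq (here , there j∈) = h refl j (suc-injective eq) j∈
independent-∷ h ind (suc i) (suc j) eq (there i∈ , there j∈) = ind i j (suc-injective eq) (i∈ , j∈)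

-- Signs alternate along the kept vertices, so two adjacent kept vertices have opposite signs.
signed-independent : ∀ b → Walk h c E T σ p z → IndependentPath n (signed b z)
signed-independent b (stop _ _) ()
signed-independent b (spare {σ = σ} _ w) =
  independent-∷ (λ { s zero _ v∈ → hasSign-not b σ s (head-sign b w v∈) }) (signed-independent b w)
signed-independent b (keep {σ = σ} w) =
  independent-∷ (λ { s zero _ v∈ → hasSign-not b σ s (head-sign b w v∈) }) (signed-independent b w)
signed-independent true (drop _ w) = independent-∷ (λ ()) (signed-independent true w)
signed-independent false (drop _ w) = independent-∷ (λ ()) (signed-independent false w)

signed-disjoint : ∀ (z : Vec (Maybe Bool) n) → Empty (signed true z ∩ signed false z)
signed-disjoint (just true  ∷ z) (suc v , there v∈) = signed-disjoint z (v , v∈)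
signed-disjoint (just false ∷ z) (suc v , there v∈) = signed-disjoint z (v , v∈)
signed-disjoint (nothing    ∷ z) (suc v , there v∈) = signed-disjoint z (v , v∈)

-- The initial sign is ahead by zero or one. This one-sided form survives induction, as prepending a
-- kept vertex exchanges the roles.
signed-size : Walk h c E T σ p z → ∣ signed (not σ) z ∣ ≤ ∣ signed σ z ∣ × ∣ signed σ z ∣ ≤ suc ∣ signed (not σ) z ∣
signed-size (stop _ _) = z≤n , z≤n
signed-size (spare {σ = true}  _ w) = let l , u = signed-size w in u , s≤s l
signed-size (spare {σ = false} _ w) = let l , u = signed-size w in u , s≤s l
signed-size (keep {σ = true}  w) = let l , u = signed-size w in u , s≤s l
signed-size (keep {σ = false} w) = let l , u = signed-size w in u , s≤s l
signed-size (drop {σ = true}  _ w) = signed-size w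
signed-size (drop {σ = false} _ w) = signed-size w

-- The omitted vertices

covered : Vec (Maybe Bool) n → Subset n
covered z = signed true z ∪ signed false z

covered-kept : ∀ σ → (hasSign true (just σ) ∨ hasSign false (just σ)) ≡ true
covered-kept true  = refl
covered-kept false = refl

missing-kept : ∀ {c : Fin (suc n) → Fin m} {A B : Set} {j} σ →
  (A → ExactlyOneMissing (c ∘ suc) (covered z) j) × (B → ∀ v → c (suc v) ≡ j → v ∈ covered z) →
  (A → ExactlyOneMissing c (covered (just σ ∷ z)) j) × (B → ∀ v → c v ≡ j → v ∈ covered (just σ ∷ z))
missing-kept {z = z} {c = c} {j = j} σ (one , none) rewrite covered-kept σ = one′ , none′
  where
  one′ : _ → ExactlyOneMissing c (true ∷ covered z) j
  one′ a with v , cv , v∉ , unique ← one a =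
    suc v , cv , (λ { (there v∈) → v∉ v∈ })
    , λ { zero _ 0∉ → contradiction here 0∉
        ; (suc u) eq u∉ → cong suc (unique u eq (u∉ ∘ there)) }
  none′ : _ → ∀ v → c v ≡ j → v ∈ true ∷ covered z
  none′ b zero    _  = here
  none′ b (suc v) eq = there (none b v eq)

-- `T` holds the colours that still owe a dropped vertex. Both halves are proved together:
-- uniqueness of a dropped vertex uses the second half on the rest of the path.
missing : ∀ j → Walk h c E T σ p z →
          (lookup T j ≡ true → ExactlyOneMissing c (covered z) j)
          × (lookup T j ≡ false → ∀ v → c v ≡ j → v ∈ covered z)
missing {c = c} {T = T} j (stop T⊆∅ _) =
  (λ t → contradiction (trans (sym T⊆∅) (⊈∅ T j t)) λ ()) , λ _ ()
  where
  ⊈∅ : ∀ (T : Subset m) j → lookup T j ≡ true → (T ⊆ᵇ ∅) ≡ false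
  ⊈∅ (true ∷ T) zero    refl = refl
  ⊈∅ (t ∷ T)    (suc j) eq rewrite ⊈∅ T j eq = ∧-zeroʳ (not t ∨ false)
missing j (spare {σ = σ} _ w) = missing-kept σ (missing j w)
missing j (keep {σ = σ} w) = missing-kept σ (missing j w)
missing {c = c} {z = _ ∷ z} j (drop {T = T} t w) with c zero ≟ j
... | yes refl = (λ _ → zero , refl , (λ ()) , unique)
               , λ t′ → contradiction (trans (sym t) t′) λ ()
  where
  unique : ∀ v → c v ≡ c zero → v ∉ covered (nothing ∷ z) → v ≡ zero
  unique zero    _  _  = refl
  unique (suc v) cv v∉ = contradiction
    (there (proj₂ (missing j w) (trans (lookup∘updateAt (c zero) T) (cong not t)) v cv)) v∉
... | no c₀≢j
  rewrite sym (lookup∘updateAt′ j (c zero) {not} (c₀≢j ∘ sym) T)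
  = one , λ { t zero eq → contradiction eq c₀≢j
            ; t (suc v) eq → there (proj₂ (missing j w) t v eq) }
  where
  one : lookup (flip (c zero) T) j ≡ true → ExactlyOneMissing c (covered (nothing ∷ z)) j
  one t with v , cv , v∉ , unique ← proj₁ (missing j w) t =
    suc v , cv , (λ { (there v∈) → v∉ v∈ })
    , λ { zero eq _ → contradiction eq c₀≢j
        ; (suc u) eq u∉ → cong suc (unique u eq (u∉ ∘ there)) }

-- Balance within each class

𝟙 : Bool → ℕ
𝟙 true  = 1
𝟙 false = 0

colour-size-kept : ∀ (c : Fin (suc n) → Fin m) z j {t} σ →
  ∣ part (c ∘ suc) j ∣ ≤ (∣ signed true z ∩ part (c ∘ suc) j ∣ + ∣ signed false z ∩ part (c ∘ suc) j ∣) + t →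
  ∣ part c j ∣ ≤ (∣ signed true (just σ ∷ z) ∩ part c j ∣ + ∣ signed false (just σ ∷ z) ∩ part c j ∣) + t
colour-size-kept c z j σ size with c zero ≟ j
colour-size-kept c z j true  size | yes _ = s≤s size
colour-size-kept c z j false size | yes _
  rewrite +-suc ∣ signed true z ∩ part (c ∘ suc) j ∣ ∣ signed false z ∩ part (c ∘ suc) j ∣ = s≤s size
colour-size-kept c z j true  size | no _ = size
colour-size-kept c z j false size | no _ = size

colour-size : ∀ j → Walk h c E T σ p z →
              ∣ part c j ∣ ≤ (∣ signed true z ∩ part c j ∣ + ∣ signed false z ∩ part c j ∣) + 𝟙 (lookup T j)
colour-size j (stop _ _) = z≤n
colour-size j (spare {c = c} {σ = σ} {z = z} _ w) = colour-size-kept c z j σ (colour-size j w)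
colour-size j (keep {c = c} {σ = σ} {z = z} w) = colour-size-kept c z j σ (colour-size j w)
colour-size {c = c} {z = _ ∷ z} j (drop {T = T} t w) with c zero ≟ j | colour-size j w
... | yes refl | size rewrite lookup∘updateAt (c zero) {not} T | t
  | +-suc (∣ signed true z ∩ part (c ∘ suc) (c zero) ∣ + ∣ signed false z ∩ part (c ∘ suc) (c zero) ∣) 0 = s≤s size
... | no c₀≢j  | size rewrite lookup∘updateAt′ j (c zero) {not} (c₀≢j ∘ sym) T = size

Near : ℕ → ℕ → ℕ → Set
Near x y e = x ≤ y + e × y ≤ x + e

Near-suc : ∀ {x y e} → Near x y e → Near (suc x) y (suc e)
Near-suc {x} {y} {e} (l , u) rewrite +-suc y e | +-suc x e = s≤s l , m≤n⇒m≤1+n (m≤n⇒m≤1+n u)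

-- The tally so far plus the signs still to come is invariant under tallying a vertex. A spared
-- vertex shifts it by one, paid for by its colour leaving `E`.
colour-balance : ∀ j → Walk balanced c E T σ p z →
                 Near (lookup (proj₁ p) j + ∣ signed true z ∩ part c j ∣)
                      (lookup (proj₂ p) j + ∣ signed false z ∩ part c j ∣)
                      (𝟙 (lookup E j))
colour-balance j (stop {p = x , y} _ b) with refl ← leads-swap x y b = m≤m+n _ _ , m≤m+n _ _
colour-balance {c = c} {p = x , y} {z = _ ∷ z} j (spare {E = E} {σ = true} e w) with c zero ≟ j | colour-balance j w
... | yes refl | near rewrite lookup∘updateAt (c zero) {not} E | e
  | +-suc (lookup x (c zero)) ∣ signed true z ∩ part (c ∘ suc) (c zero) ∣ = Near-suc near
... | no c₀≢j  | near rewrite lookup∘updateAt′ j (c zero) {not} (c₀≢j ∘ sym) E = near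
colour-balance {c = c} {p = x , y} {z = _ ∷ z} j (spare {E = E} {σ = false} e w) with c zero ≟ j | colour-balance j w
... | yes refl | near rewrite lookup∘updateAt (c zero) {not} E | e
  | +-suc (lookup y (c zero)) ∣ signed false z ∩ part (c ∘ suc) (c zero) ∣ = swap (Near-suc (swap near))
... | no c₀≢j  | near rewrite lookup∘updateAt′ j (c zero) {not} (c₀≢j ∘ sym) E = near
colour-balance {c = c} {p = x , y} {z = _ ∷ z} j (keep {σ = true} w) with c zero ≟ j | colour-balance j w
... | yes refl | near rewrite lookup∘updateAt (c zero) {suc} x
  | +-suc (lookup x (c zero)) ∣ signed true z ∩ part (c ∘ suc) (c zero) ∣ = near
... | no c₀≢j  | near rewrite lookup∘updateAt′ j (c zero) {suc} (c₀≢j ∘ sym) x = near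
colour-balance {c = c} {p = x , y} {z = _ ∷ z} j (keep {σ = false} w) with c zero ≟ j | colour-balance j w
... | yes refl | near rewrite lookup∘updateAt (c zero) {suc} y
  | +-suc (lookup y (c zero)) ∣ signed false z ∩ part (c ∘ suc) (c zero) ∣ = near
... | no c₀≢j  | near rewrite lookup∘updateAt′ j (c zero) {suc} (c₀≢j ∘ sym) y = near
colour-balance j (drop _ w) = colour-balance j w

𝟙≤1 : ∀ b → 𝟙 b ≤ 1
𝟙≤1 true  = ≤-refl
𝟙≤1 false = z≤n

-- The constant 2 spends one unit on the dropped vertex and one on the spared vertex.
at-least-half : ∀ {v} a b t e → v ≤ (a + b) + 𝟙 t → b ≤ a + 𝟙 e → v ≤ 2 * a + 2
at-least-half {v} a b t e size near = begin
  v                 ≤⟨ size ⟩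
  (a + b) + 𝟙 t     ≤⟨ +-mono-≤ (+-monoʳ-≤ a (≤-trans near (+-monoʳ-≤ a (𝟙≤1 e)))) (𝟙≤1 t) ⟩
  (a + (a + 1)) + 1 ≡⟨ solve 1 (λ a → (a :+ (a :+ con 1)) :+ con 1 := con 2 :* a :+ con 2) refl a ⟩
  2 * a + 2         ∎
  where
  open ≤-Reasoning
  open +-*-Solver

theorem1 : (n m : ℕ) (c : Fin n → Fin m) → Surjective c →
    ∃[ S₁ ] ∃[ S₂ ]
    (IndependentPath n S₁ × IndependentPath n S₂ × Empty (S₁ ∩ S₂)
    × (∀ j → ExactlyOneMissing c (S₁ ∪ S₂) j)
    × ∣ S₁ ∣ ≤ ∣ S₂ ∣ + 1 × ∣ S₂ ∣ ≤ ∣ S₁ ∣ + 1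
    × (∀ j → ∣ part c j ∣ ≤ 2 * ∣ S₁ ∩ part c j ∣ + 2)
    × (∀ j → ∣ part c j ∣ ≤ 2 * ∣ S₂ ∩ part c j ∣ + 2))
theorem1 n m c surj =
  signed true s , signed false s
  , signed-independent true w , signed-independent false w , signed-disjoint s
  , (λ j → proj₁ (missing j w) (lookup-replicate j true))
  -- The walk starts with +, so the positive class is ahead by zero or one.
  , ≤-trans (proj₂ sizes) (≤-reflexive (+-comm 1 _))
  , ≤-trans (proj₁ sizes) (m≤m+n _ 1)
  , (λ j → at-least-half (#₁ j) (#₂ j) (lookup all j) (lookup evens j) (colour-size j w) (proj₂ (balance j)))
  , (λ j → at-least-half (#₂ j) (#₁ j) (lookup all j) (lookup evens j)
             (subst (λ k → ∣ part c j ∣ ≤ k + 𝟙 (lookup all j)) (+-comm (#₁ j) (#₂ j)) (colour-size j w))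
             (proj₁ (balance j)))
  where
  all evens : Subset m
  all   = ⊤
  evens = evenColours c
  found = walks⇒Walk balanced n c evens all true start (walks-balanced c surj)
  s = proj₁ found
  w = proj₂ found
  sizes = signed-size w
  #₁ #₂ : Fin m → ℕ
  #₁ j = ∣ signed true s ∩ part c j ∣
  #₂ j = ∣ signed false s ∩ part c j ∣
  balance : ∀ j → Near (#₁ j) (#₂ j) (𝟙 (lookup evens j))
  -- At the start the tally is zero, so the invariant compares the bare counts.
  balance j = subst (λ x → Near (x + #₁ j) (x + #₂ j) (𝟙 (lookup evens j)))
                    (lookup-replicate j 0) (colour-balance j w)
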